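{- For every connected graph $G$, $$\alpha_b(G)\leq 4\alpha(G).$$
   Context: All graphs are finite, simple, undirected, and nonempty. $\mathbb{N}_0$ is the set of nonnegative integers, $\mathrm{dist}_G$ denotes distance in $G$, $\mathrm{ecc}_G(x)$ the eccentricity of $x$ in $G$, and $\alpha(G)$ the independence number of $G$ (maximum cardinality of a set of pairwise nonadjacent vertices). For a connected graph $G$, a function $f:V(G)\to\mathbb{N}_0$ is an independent broadcast on $G$ if (B1) $f(x)\leq \mathrm{ecc}_G(x)$ for every vertex $x$ of $G$, and (B2) $\mathrm{dist}_G(x,y)>\max\{f(x),f(y)\}$ for every two distinct vertices $x,y$ of $G$ with $f(x),f(y)>0$. The weight of $f$ is $\sum_{x\in V(G)}f(x)$. The broadcast independence number $\alpha_b(G)$ is the maximum weight of an independent broadcast on $G$. -}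

module Defs where

open import Algebra.Properties.CommutativeMonoid.Sum using (sum-cong-≗)
open import Data.Fin.Base using (Fin; zero; suc; toℕ; fromℕ<)
open import Data.Fin.Properties using (_≟_; any?; all?; toℕ<n; toℕ-fromℕ<)
open import Data.Fin.Subset using (Subset; _∈_; ∣_∣; ⊥)
open import Data.Fin.Subset.Properties using (_∈?_; anySubset?; ∣p∣≤n; ∣⊥∣≡0; ∉⊥)
open import Data.Nat.Base using (ℕ; zero; suc; _⊔_; _≤_; _<_; z≤n; s≤s; NonZero)
import Data.Nat.Properties as ℕ
open import Data.Product using (∃; _×_; _,_; proj₁)
open import Data.Vec.Functional using (Vector; tail) renaming (_∷_ to _◂_)
open import Function.Base using (_∘_)
open import Level using (0ℓ)
open import Relation.Binary.Core using (Rel)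
open import Relation.Binary.Definitions using (Decidable; Symmetric; Irreflexive)
open import Relation.Binary.PropositionalEquality
  using (_≡_; _≢_; _≗_; refl; sym; trans; subst)
open import Relation.Nullary using (¬_; Dec; yes; no; ¬?; contradiction; _×-dec_; _→-dec_)
open import Relation.Nullary.Decidable using (map′)
open import Relation.Unary using (Pred) renaming (Decidable to Decidable₁)

open Algebra.Properties.CommutativeMonoid.Sum ℕ.+-0-commutativeMonoid public
  using (sum)

------------------------------------------------------------------------
-- Minima and maxima of sets of natural numbers

IsMinimum IsMaximum : Pred ℕ 0ℓ → ℕ → Set
IsMinimum P m = P m × (∀ k → P k → m ≤ k)
IsMaximum P m = P m × (∀ k → P k → k ≤ m)

minimum : {P : Pred ℕ 0ℓ} → Decidable₁ P → ∃ P → ∃ (IsMinimum P)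
minimum P? (b , pb) = go b P? pb
  where
  go : {P : Pred ℕ 0ℓ} → ∀ b → Decidable₁ P → P b → ∃ (IsMinimum P)
  go zero P? p = 0 , p , λ _ _ → z≤n
  go {P} (suc b) P? p with P? 0
  ... | yes p₀ = 0 , p₀ , λ _ _ → z≤n
  ... | no ¬p₀ with go {P ∘ suc} b (P? ∘ suc) p
  ...   | m , pm , least = suc m , pm , λ where
    zero    pk → contradiction pk ¬p₀
    (suc k) pk → s≤s (least k pk)

maximum : {P : Pred ℕ 0ℓ} → Decidable₁ P → ∃ P →
          ∃ (λ b → ∀ k → P k → k ≤ b) → ∃ (IsMaximum P)
maximum {P} P? (w , pw) (b , bounded) = go b bounded
  where
  go : ∀ b → (∀ k → P k → k ≤ b) → ∃ (IsMaximum P)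
  go b bounded with P? b
  ... | yes pb = b , pb , bounded
  go zero bounded | no ¬pb =
    contradiction (subst P (ℕ.n≤0⇒n≡0 (bounded w pw)) pw) ¬pb
  go (suc b) bounded | no ¬pb = go b λ k pk →
    ℕ.≤-pred (ℕ.≤∧≢⇒< (bounded k pk) λ { refl → ¬pb pk })

≤-sum : ∀ {n} (d : Vector ℕ n) x → d x ≤ sum d
≤-sum d zero    = ℕ.m≤m+n (d zero) _
≤-sum d (suc x) = ℕ.≤-trans (≤-sum (tail d) x) (ℕ.m≤n+m _ (d zero))

sum-mono-≤ : ∀ {n} {f g : Vector ℕ n} → (∀ x → f x ≤ g x) → sum f ≤ sum g
sum-mono-≤ {zero}  f≤g = z≤n
sum-mono-≤ {suc n} f≤g = ℕ.+-mono-≤ (f≤g zero) (sum-mono-≤ (f≤g ∘ suc))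

-- Functions bounded by b form a finite set up to pointwise equality.
anyBounded? : ∀ {n} (b : Vector ℕ n) {Q : Pred (Vector ℕ n) 0ℓ} →
              (∀ {f g} → f ≗ g → Q f → Q g) → Decidable₁ Q →
              Dec (∃ λ f → (∀ x → f x ≤ b x) × Q f)
anyBounded? {zero} b resp Q? =
  map′ (λ q → empty , (λ ()) , q) (λ (f , _ , q) → resp (λ ()) q) (Q? empty)
  where
  empty : Vector ℕ 0
  empty ()
anyBounded? {suc n} b {Q} resp Q? = map′ to from
  (any? λ i → anyBounded? (tail b) (λ f≗g → resp (cons-cong (toℕ i) f≗g))
                                   (λ f → Q? (toℕ i ◂ f)))
  where
  cons-cong : ∀ k {f g : Vector ℕ n} → f ≗ g → (k ◂ f) ≗ (k ◂ g)
  cons-cong k f≗g zero    = refl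
  cons-cong k f≗g (suc x) = f≗g x

  Tail : Fin (suc (b zero)) → Set
  Tail i = ∃ λ f → (∀ x → f x ≤ tail b x) × Q (toℕ i ◂ f)

  to : ∃ Tail → ∃ λ f → (∀ x → f x ≤ b x) × Q f
  to (i , f , f≤b , q) = toℕ i ◂ f , bound , q
    where
    bound : ∀ x → (toℕ i ◂ f) x ≤ b x
    bound zero    = ℕ.≤-pred (toℕ<n i)
    bound (suc x) = f≤b x

  from : (∃ λ f → (∀ x → f x ≤ b x) × Q f) → ∃ Tail
  from (f , f≤b , q) = fromℕ< f₀< , tail f , f≤b ∘ suc , resp split q
    where
    f₀< : f zero < suc (b zero)
    f₀< = s≤s (f≤b zero)

    split : f ≗ (toℕ (fromℕ< f₀<) ◂ tail f)
    split zero    = sym (toℕ-fromℕ< f₀<)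
    split (suc x) = refl

------------------------------------------------------------------------
-- Graphs

-- Decidability of adjacency is automatic classically.
record Graph : Set₁ where
  infix 4 _~_ _~?_
  field
    order        : ℕ
    ⦃ nonEmpty ⦄ : NonZero order

  V : Set
  V = Fin order

  field
    _~_      : Rel V 0ℓ
    _~?_     : Decidable _~_
    ~-sym    : Symmetric _~_
    ~-irrefl : Irreflexive _≡_ _~_

module _ (G : Graph) where
  open Graph G

  data Walk : ℕ → V → V → Set where
    []  : ∀ {x} → Walk 0 x x
    _∷_ : ∀ {k x y z} → x ~ y → Walk k y z → Walk (suc k) x z

  Connected : Set
  Connected = ∀ x y → ∃ λ k → Walk k x y

  Independent : Subset order → Set
  Independent S = ∀ x y → x ∈ S → y ∈ S → ¬ (x ~ y)

  walk? : ∀ k x y → Dec (Walk k x y)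
  walk? zero    x y = map′ (λ { refl → [] }) (λ { [] → refl }) (x ≟ y)
  walk? (suc k) x y =
    map′ (λ (_ , e , w) → e ∷ w) (λ { (e ∷ w) → _ , e , w })
         (any? λ z → (x ~? z) ×-dec walk? k z y)

  independent? : Decidable₁ Independent
  independent? S = all? λ x → all? λ y →
    (x ∈? S) →-dec ((y ∈? S) →-dec ¬? (x ~? y))

  IsIndependenceNumber : ℕ → Set
  IsIndependenceNumber = IsMaximum λ k → ∃ λ S → Independent S × ∣ S ∣ ≡ k

  independenceNumber : ∃ IsIndependenceNumber
  independenceNumber = maximum
    (λ k → anySubset? λ S → independent? S ×-dec (∣ S ∣ ℕ.≟ k))
    (0 , ⊥ , (λ _ _ x∈⊥ → contradiction x∈⊥ ∉⊥) , ∣⊥∣≡0 order)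
    (order , λ { _ (S , _ , refl) → ∣p∣≤n S })

  α : ℕ
  α = proj₁ independenceNumber

------------------------------------------------------------------------
-- Distance, eccentricity and broadcasts in a connected graph

module _ (G : Graph) (conn : Connected G) where
  open Graph G

  -- A walk of minimum length is a path, so this is the usual distance.
  IsDistance : V → V → ℕ → Set
  IsDistance x y = IsMinimum λ k → Walk G k x y

  distance : ∀ x y → ∃ (IsDistance x y)
  distance x y = minimum (λ k → walk? G k x y) (conn x y)

  dist : V → V → ℕ
  dist x y = proj₁ (distance x y)

  IsEccentricity : V → ℕ → Set
  IsEccentricity x = IsMaximum λ k → ∃ λ y → dist x y ≡ k

  eccentricity : ∀ x → ∃ (IsEccentricity x)
  eccentricity x = maximum
    (λ k → any? λ y → dist x y ℕ.≟ k)
    (dist x x , x , refl)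
    (sum (dist x) , λ { _ (y , refl) → ≤-sum (dist x) y })

  ecc : V → ℕ
  ecc x = proj₁ (eccentricity x)

  Separated : (V → ℕ) → Set
  Separated f = ∀ x y → x ≢ y → 0 < f x → 0 < f y → f x ⊔ f y < dist x y

  IndependentBroadcast : (V → ℕ) → Set
  IndependentBroadcast f = (∀ x → f x ≤ ecc x) × Separated f

  weight : (V → ℕ) → ℕ
  weight f = sum f

  separated? : Decidable₁ Separated
  separated? f = all? λ x → all? λ y →
    ¬? (x ≟ y) →-dec ((0 ℕ.<? f x) →-dec ((0 ℕ.<? f y) →-dec
      (f x ⊔ f y ℕ.<? dist x y)))

  separated-resp : ∀ {f g} → f ≗ g → Separated f → Separated g
  separated-resp f≗g sep x y x≢y 0<gx 0<gy
    rewrite sym (f≗g x) | sym (f≗g y) = sep x y x≢y 0<gx 0<gy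

  IsBroadcastIndependenceNumber : ℕ → Set
  IsBroadcastIndependenceNumber =
    IsMaximum λ k → ∃ λ f → IndependentBroadcast f × weight f ≡ k

  broadcastIndependenceNumber : ∃ IsBroadcastIndependenceNumber
  broadcastIndependenceNumber = maximum
    (λ k → map′ (λ (f , b , s , w) → f , (b , s) , w)
                (λ (f , (b , s) , w) → f , b , s , w)
                (anyBounded? ecc
                  (λ f≗g (s , w) → separated-resp f≗g s ,
                     trans (sym (sum-cong-≗ ℕ.+-0-commutativeMonoid f≗g)) w)
                  (λ f → separated? f ×-dec (weight f ℕ.≟ k))))
    (weight (λ _ → 0) , (λ _ → 0) , ((λ _ → z≤n) , λ _ _ _ ()) , refl)
    (sum ecc , λ { _ (f , (b , _) , refl) → sum-mono-≤ b })

  αb : ℕ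
  αb = proj₁ broadcastIndependenceNumber

{-# OPTIONS --safe #-}

-- Let f be an independent broadcast.  For every vertex x and every k with
-- 4k < f(x) choose a vertex at distance exactly 2k from x, which exists since
-- f(x) ≤ ecc(x).  Two vertices chosen for the same x have distances from x
-- that differ by at least 2; if u and v are chosen for x ≠ y, with parameters
-- k and l, then 2k + 2l + 1 ≤ max(f(x), f(y)) < dist(x, y) ≤ 2k + dist(u, v) + 2l.
-- So distinct choices are at distance at least 2, and the chosen vertices form
-- an independent set of size Σ ⌈f(x)/4⌉.

module Submission where

open import Defs
open import Algebra.Properties.CommutativeMonoid.Sum using (sum-cong-≗)
open import Data.Fin.Base as Fin using (Fin; zero; suc; toℕ)
open import Data.Fin.Properties using (toℕ<n)
open import Data.Fin.Subset using (Subset; _∈_; _∪_; ⁅_⁆; ∣_∣; ⊥)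
open import Data.Fin.Subset.Properties
  using (p⊂q⇒∣p∣<∣q∣; q⊆p∪q; p⊆p∪q; x∈⁅x⁆; x∈⁅y⁆⇒x≡y; x∈p∪q⁻; ∉⊥)
open import Data.List.Base using (List; []; _∷_; foldr; length; tabulate; concat)
open import Data.List.Membership.Propositional using () renaming (_∈_ to _∈ₗ_)
open import Data.List.Properties using (length-++; length-tabulate)
open import Data.List.Relation.Unary.All as All using ()
open import Data.List.Relation.Unary.All.Properties as All using ()
open import Data.List.Relation.Unary.AllPairs as AP using (AllPairs; []; _∷_)
open import Data.List.Relation.Unary.AllPairs.Properties as AllPairs using ()
open import Data.List.Relation.Unary.Any using (here; there)
open import Data.Nat.Base
  using (ℕ; zero; suc; _+_; _∸_; _*_; _⊔_; _≤_; _<_; z≤n; s≤s)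
open import Data.Nat.DivMod using (_/_; _%_; m≡m%n+[m/n]*n; m%n<n; m/n*n≤m)
open import Data.Nat.Properties
open import Data.Nat.Tactic.RingSolver using (solve-∀)
open import Data.Product using (∃; _×_; _,_; proj₁; proj₂)
open import Data.Sum.Base using (inj₁; inj₂)
open import Function.Base using (_∘_)
open import Relation.Binary.PropositionalEquality
  using (_≡_; _≢_; refl; sym; trans; cong; cong₂; subst)
open import Relation.Nullary using (¬_; contradiction)

open ≤-Reasoning

⌈_/4⌉ : ℕ → ℕ
⌈ n /4⌉ = (n + 3) / 4

n≤4*⌈n/4⌉ : ∀ n → n ≤ 4 * ⌈ n /4⌉
n≤4*⌈n/4⌉ n = +-cancelˡ-≤ 3 _ _ (begin
  3 + n                           ≡⟨ +-comm 3 n ⟩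
  n + 3                           ≡⟨ m≡m%n+[m/n]*n (n + 3) 4 ⟩
  -- The remainder is at most 3, exactly the amount added to `n` for rounding up, so the two cancel.
  (n + 3) % 4 + ⌈ n /4⌉ * 4       ≤⟨ +-mono-≤ (≤-pred (m%n<n (n + 3) 4)) (≤-reflexive (*-comm ⌈ n /4⌉ 4)) ⟩
  3 + 4 * ⌈ n /4⌉                 ∎)

k<⌈n/4⌉⇒4*k<n : ∀ {k n} → k < ⌈ n /4⌉ → 4 * k < n
k<⌈n/4⌉⇒4*k<n {k} {n} k< = +-cancelʳ-≤ 3 _ _ (begin
  suc (4 * k) + 3   ≡⟨ shift k ⟩
  suc k * 4         ≤⟨ *-monoˡ-≤ 4 k< ⟩
  ⌈ n /4⌉ * 4       ≤⟨ m/n*n≤m (n + 3) 4 ⟩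
  n + 3             ∎)
  where
  shift : ∀ k → suc (4 * k) + 3 ≡ suc k * 4
  shift = solve-∀

sum-*-≤ : ∀ {n} c {f g : Fin n → ℕ} → (∀ x → f x ≤ c * g x) → sum f ≤ c * sum g
sum-*-≤ {zero}  c f≤cg = z≤n
sum-*-≤ {suc n} c {f} {g} f≤cg = begin
  f zero + sum (f ∘ suc)          ≤⟨ +-mono-≤ (f≤cg zero) (sum-*-≤ c (f≤cg ∘ suc)) ⟩
  c * g zero + c * sum (g ∘ suc)  ≡⟨ *-distribˡ-+ c (g zero) _ ⟨
  c * (g zero + sum (g ∘ suc))    ∎

length-concat-tabulate : ∀ {A : Set} {n} (xss : Fin n → List A) →
                         length (concat (tabulate xss)) ≡ sum (length ∘ xss)
length-concat-tabulate {n = zero}  xss = refl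
length-concat-tabulate {n = suc n} xss =
  trans (length-++ (xss zero)) (cong (length (xss zero) +_) (length-concat-tabulate (xss ∘ suc)))

fromList : ∀ {n} → List (Fin n) → Subset n
fromList = foldr (λ x p → ⁅ x ⁆ ∪ p) ⊥

∈-fromList⁻ : ∀ {n} (xs : List (Fin n)) {x} → x ∈ fromList xs → x ∈ₗ xs
∈-fromList⁻ []       x∈ = contradiction x∈ ∉⊥
∈-fromList⁻ (y ∷ xs) x∈ with x∈p∪q⁻ ⁅ y ⁆ (fromList xs) x∈
... | inj₁ x∈y = here (x∈⁅y⁆⇒x≡y y x∈y)
... | inj₂ x∈p = there (∈-fromList⁻ xs x∈p)

-- Each head lies outside the set built from its tail, so adding it enlarges that set strictly.
length≤∣fromList∣ : ∀ {n} {xs : List (Fin n)} → AllPairs _≢_ xs → length xs ≤ ∣ fromList xs ∣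
length≤∣fromList∣ []                     = z≤n
length≤∣fromList∣ {xs = x ∷ xs} (x≢ ∷ u) = <-≤-trans (s≤s (length≤∣fromList∣ u))
  (p⊂q⇒∣p∣<∣q∣ (q⊆p∪q ⁅ x ⁆ (fromList xs) , x , p⊆p∪q (fromList xs) (x∈⁅x⁆ x) ,
    λ x∈ → All.lookup x≢ (∈-fromList⁻ xs x∈) refl))

module _ (G : Graph) where
  open Graph G

  NonAdjacent : V → V → Set
  NonAdjacent x y = ¬ (x ~ y)

  -- `AllPairs` covers only pairs in list order. Symmetry of adjacency supplies the reversed pairs
  -- and irreflexivity the diagonal.
  fromList-independent : ∀ {xs} → AllPairs NonAdjacent xs → Independent G (fromList xs)
  fromList-independent {xs} apart x y x∈ y∈ =
    go apart (∈-fromList⁻ xs x∈) (∈-fromList⁻ xs y∈)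
    where
    go : ∀ {xs} → AllPairs NonAdjacent xs → x ∈ₗ xs → y ∈ₗ xs → NonAdjacent x y
    go (_ ∷ _)  (here refl) (here refl) = ~-irrefl refl
    go (na ∷ _) (here refl) (there y∈)  = All.lookup na y∈
    go (na ∷ _) (there x∈)  (here refl) = All.lookup na x∈ ∘ ~-sym
    go (_ ∷ ap) (there x∈)  (there y∈)  = go ap x∈ y∈

  length≤α : ∀ {xs} → AllPairs _≢_ xs → AllPairs NonAdjacent xs → length xs ≤ α G
  length≤α {xs} unique apart = ≤-trans (length≤∣fromList∣ unique)
    (proj₂ (proj₂ (independenceNumber G)) _ (fromList xs , fromList-independent apart , refl))

  _++ʷ_ : ∀ {i j x y z} → Walk G i x y → Walk G j y z → Walk G (i + j) x z
  []      ++ʷ w = w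
  (e ∷ v) ++ʷ w = e ∷ (v ++ʷ w)

  reverseʷ : ∀ {k x y} → Walk G k x y → Walk G k y x
  reverseʷ []                      = []
  reverseʷ {suc k} {x} {y} (e ∷ w) =
    subst (λ m → Walk G m y x) (+-comm k 1) (reverseʷ w ++ʷ (~-sym e ∷ []))

  splitʷ : ∀ i {j x z} → Walk G (i + j) x z → ∃ λ y → Walk G i x y × Walk G j y z
  splitʷ zero    w       = _ , [] , w
  splitʷ (suc i) (e ∷ w) = let y , u , v = splitʷ i w in y , e ∷ u , v

module _ (G : Graph) (conn : Connected G) where
  open Graph G

  private
    d : V → V → ℕ
    d = dist G conn

  geodesic : ∀ x y → Walk G (d x y) x y
  geodesic x y = proj₁ (proj₂ (distance G conn x y))

  dist≤ : ∀ {k x y} → Walk G k x y → d x y ≤ k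
  dist≤ {k} {x} {y} w = proj₂ (proj₂ (distance G conn x y)) k w

  dist-triangle : ∀ x y z → d x z ≤ d x y + d y z
  dist-triangle x y z = dist≤ (_++ʷ_ G (geodesic x y) (geodesic y z))

  dist-sym : ∀ x y → d x y ≡ d y x
  dist-sym x y = ≤-antisym (dist≤ (reverseʷ G (geodesic y x))) (dist≤ (reverseʷ G (geodesic x y)))

  1<dist⇒≢ : ∀ {x y} → 1 < d x y → x ≢ y
  1<dist⇒≢ 1<d refl = contradiction (≤-trans 1<d (dist≤ [])) λ ()

  1<dist⇒NonAdjacent : ∀ {x y} → 1 < d x y → NonAdjacent G x y
  1<dist⇒NonAdjacent 1<d e = <⇒≱ 1<d (dist≤ (e ∷ []))

  -- Cut a geodesic after `k` steps. The first piece bounds the distance from `x` by `k`; a shorter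
  -- route to the cut vertex would, by the triangle inequality, shorten the geodesic.
  between : ∀ {x y k} → k ≤ d x y → ∃ λ z → d x z ≡ k
  between {x} {y} {k} k≤d =
    let z , u , v = splitʷ G k (subst (λ m → Walk G m x y) (sym k+[d∸k]≡d) (geodesic x y))
    in  z , ≤-antisym (dist≤ u) (+-cancelʳ-≤ (d x y ∸ k) k (d x z) (begin
      k + (d x y ∸ k)      ≡⟨ k+[d∸k]≡d ⟩
      d x y                ≤⟨ dist-triangle x z y ⟩
      d x z + d z y        ≤⟨ +-monoʳ-≤ (d x z) (dist≤ v) ⟩
      d x z + (d x y ∸ k)  ∎))
    where
    k+[d∸k]≡d : k + (d x y ∸ k) ≡ d x y
    k+[d∸k]≡d = m+[n∸m]≡n k≤d

  -- The eccentricity is attained at some `y`, and a geodesic to `y` passes through every smaller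
  -- distance.
  atDistance : ∀ {x k} → k ≤ ecc G conn x → ∃ λ z → d x z ≡ k
  atDistance {x} k≤ecc with proj₁ (proj₂ (eccentricity G conn x))
  ... | y , dxy≡ecc = between (subst (_ ≤_) (sym dxy≡ecc) k≤ecc)

  module _ {f : V → ℕ} (broadcast : IndependentBroadcast G conn f) where

    private
      -- The indices are the `k` with `4 * k < f x`; there are none when `f x` is 0.
      Index : V → Set
      Index x = Fin ⌈ f x /4⌉

    4*index<f : ∀ {x} (i : Index x) → 4 * toℕ i < f x
    4*index<f i = k<⌈n/4⌉⇒4*k<n (toℕ<n i)

    chosen : ∀ {x} (i : Index x) → ∃ λ z → d x z ≡ 2 * toℕ i
    chosen {x} i = atDistance (begin
      2 * toℕ i   ≤⟨ *-monoˡ-≤ (toℕ i) {2} {4} (s≤s (s≤s z≤n)) ⟩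
      4 * toℕ i   ≤⟨ <⇒≤ (4*index<f i) ⟩
      f x         ≤⟨ proj₁ broadcast x ⟩
      ecc G conn x ∎)

    choice : ∀ {x} → Index x → V
    choice i = proj₁ (chosen i)

    dist-choice : ∀ {x} (i : Index x) → d x (choice i) ≡ 2 * toℕ i
    dist-choice i = proj₂ (chosen i)

    -- The triangle inequality through `choice i` bounds the gap between the distances `2 * toℕ i`
    -- and `2 * toℕ j` from `x`, which is at least 2.
    far-within : ∀ {x} {i j : Index x} → i Fin.< j → 1 < d (choice i) (choice j)
    far-within {x} {i} {j} i<j = +-cancelˡ-≤ (2 * toℕ i) _ _ (begin
      2 * toℕ i + 2                            ≡⟨ shift (toℕ i) ⟩
      2 * suc (toℕ i)                          ≤⟨ *-monoʳ-≤ 2 i<j ⟩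
      2 * toℕ j                                ≡⟨ dist-choice j ⟨
      d x (choice j)                           ≤⟨ dist-triangle x (choice i) (choice j) ⟩
      d x (choice i) + d (choice i) (choice j) ≡⟨ cong (_+ d (choice i) (choice j)) (dist-choice i) ⟩
      2 * toℕ i + d (choice i) (choice j)      ∎)
      where
      shift : ∀ k → 2 * k + 2 ≡ 2 * suc k
      shift = solve-∀

    far-between : ∀ {x y} → x ≢ y → (i : Index x) (j : Index y) → 1 < d (choice i) (choice j)
    far-between {x} {y} x≢y i j = +-cancelˡ-< (2 * k + 2 * l) 1 _ (begin-strict
      2 * k + 2 * l + 1            ≤⟨ *-cancelˡ-≤ 2 double ⟩
      -- Separation needs positive values; having an index at `x` and at `y` forces them.
      f x ⊔ f y                    <⟨ proj₂ broadcast x y x≢y (≤-<-trans z≤n 4k<fx) (≤-<-trans z≤n 4l<fy) ⟩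
      d x y                        ≤⟨ dist-triangle x u y ⟩
      d x u + d u y                ≤⟨ +-monoʳ-≤ (d x u) (dist-triangle u v y) ⟩
      d x u + (d u v + d v y)      ≡⟨ cong₂ (λ a b → a + (d u v + b)) (dist-choice i)
                                        (trans (dist-sym v y) (dist-choice j)) ⟩
      2 * k + (d u v + 2 * l)      ≡⟨ regroup k l (d u v) ⟩
      2 * k + 2 * l + d u v        ∎)
      where
      k l : ℕ
      k = toℕ i
      l = toℕ j

      u v : V
      u = choice i
      v = choice j

      4k<fx : 4 * k < f x
      4k<fx = 4*index<f i

      4l<fy : 4 * l < f y
      4l<fy = 4*index<f j

      -- The trailing 0 matches the unfolding of `2 * m` to `m + (m + 0)`, so that `double` can
      -- compare summand by summand.
      split : ∀ k l → 2 * (2 * k + 2 * l + 1) ≡ suc (4 * k) + (suc (4 * l) + 0)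
      split = solve-∀

      regroup : ∀ k l m → 2 * k + (m + 2 * l) ≡ 2 * k + 2 * l + m
      regroup = solve-∀

      -- The maximum is at least the average of `f x` and `f y`, hence at least that of `4 * k + 1`
      -- and `4 * l + 1`.
      double : 2 * (2 * k + 2 * l + 1) ≤ 2 * (f x ⊔ f y)
      double = ≤-trans (≤-reflexive (split k l))
        (+-mono-≤ (≤-trans 4k<fx (m≤m⊔n (f x) (f y)))
                  (+-monoˡ-≤ 0 (≤-trans 4l<fy (m≤n⊔m (f x) (f y)))))

    choices : List V
    choices = concat (tabulate λ x → tabulate (choice {x}))

    -- The list has one block per vertex: `far-within` handles pairs inside a block, `far-between`
    -- pairs from different blocks.
    choices-far : AllPairs (λ u v → 1 < d u v) choices
    choices-far = AllPairs.concat⁺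
      (All.tabulate⁺ λ x → AllPairs.tabulate⁺-< far-within)
      (AllPairs.tabulate⁺ λ x≢y → All.tabulate⁺ λ i → All.tabulate⁺ λ j → far-between x≢y i j)

    weight≤4*α : weight G conn f ≤ 4 * α G
    weight≤4*α = begin
      sum f                          ≤⟨ sum-*-≤ 4 (n≤4*⌈n/4⌉ ∘ f) ⟩
      4 * sum (λ x → ⌈ f x /4⌉)      ≡⟨ cong (4 *_) (sum-cong-≗ +-0-commutativeMonoid λ x → length-tabulate (choice {x})) ⟨
      4 * sum (λ x → length (tabulate (choice {x})))
                                     ≡⟨ cong (4 *_) (length-concat-tabulate (λ x → tabulate (choice {x}))) ⟨
      -- Distance above 1 gives both distinctness, so that no vertex is counted twice, and
      -- nonadjacency.
      4 * length choices             ≤⟨ *-monoʳ-≤ 4 (length≤α G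
                                          (AP.map 1<dist⇒≢ choices-far)
                                          (AP.map 1<dist⇒NonAdjacent choices-far)) ⟩
      4 * α G                        ∎

mainTheorem2 : (G : Graph) (conn : Connected G) → αb G conn ≤ 4 * α G
-- The maximum weight is attained, so bounding the weight of one optimal broadcast suffices.
mainTheorem2 G conn with proj₁ (proj₂ (broadcastIndependenceNumber G conn))
... | f , broadcast , weight≡αb = subst (_≤ 4 * α G) weight≡αb (weight≤4*α G conn broadcast)
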